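{- Let $A=[a_{ij}]\in M_{m,n}(\mathbb{R})$ have rank $r\geq 1$ and be properly arranged. Then $A$ is diagonally eliminable up to $r$. Moreover, $|a^{(2k)}_{k+1,k+1}|\geq |a^{(2k)}_{ij}|$ for all $k$ with $0\leq k<r$ and all $i,j$ with $k+1\leq i\leq m$, $k+1\leq j\leq n$.
   Context: Gauss-Jordan procedure: for $A\in M_{m,n}(\mathbb{R})$ set $A^{(0)}=A$. For $k\geq 0$, if $A^{(2k)}=[a^{(2k)}_{ij}]$ is defined and $a^{(2k)}_{k+1,k+1}\neq 0$, let $\mathcal{G}_{2k+1}$ be the $m\times m$ diagonal matrix with all diagonal entries $1$ except the $(k+1,k+1)$ entry, which is $1/a^{(2k)}_{k+1,k+1}$, and set $A^{(2k+1)}=\mathcal{G}_{2k+1}A^{(2k)}=[a^{(2k+1)}_{ij}]$; then let $\mathcal{G}_{2k+2}=[g_{ij}]_{m\times m}$ with $g_{ii}=1$, $g_{i,k+1}=-a^{(2k+1)}_{i,k+1}$ for $i\neq k+1$, and all other entries $0$, and set $A^{(2k+2)}=\mathcal{G}_{2k+2}A^{(2k+1)}$. A matrix $A$ of rank $r\geq 1$ is diagonally eliminable up to $r$ if for each $k=1,\dots,r$ the matrix $A^{(2k-2)}$ is defined and $a^{(2k-2)}_{kk}\neq 0$. Minors: $m^{i_1\dots i_p}_{j_1\dots j_p}$ (increasing indices) is the determinant of the submatrix of $A$ with rows $i_1,\dots,i_p$ and columns $j_1,\dots,j_p$; $m_k=m^{1\dots k}_{1\dots k}$. $A$ (of rank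 $r\geq 1$) is properly arranged if $|a_{ij}|\leq|a_{11}|$ for all $1\leq i\leq m$, $1\leq j\leq n$, and for every integer $k$ with $1\leq k<\min\{m,n\}$ one has $|m^{1\dots k\,i}_{1\dots k\,j}|\leq|m_{k+1}|$ for all $k+1\leq i\leq m$, $k+1\leq j\leq n$. -}

module Defs where

open import Level using (Level; _⊔_) renaming (suc to lsuc)
open import Algebra.Bundles using (CommutativeRing)
import Algebra.Definitions.RawMonoid as RawMonoidDefs
open import Data.Fin.Base using (Fin; zero; suc; toℕ; fromℕ<; inject≤; punchIn)
import Data.Fin.Properties as Fin
open import Data.Maybe.Base using (Maybe; just; nothing; _>>=_)
open import Data.Nat.Base as ℕ using (ℕ; zero; suc; _⊓_)
import Data.Nat.Properties as ℕ
open import Data.Product.Base using (Σ; ∃; ∃-syntax; _×_; _,_)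
open import Data.Vec.Functional using (Vector; _++_)
open import Relation.Binary.Core using (Rel)
open import Relation.Binary.PropositionalEquality.Core using (_≡_)
open import Relation.Binary.Structures using (IsDecTotalOrder)
open import Relation.Nullary.Decidable.Core using (yes; no)
open import Relation.Nullary.Negation.Core using (¬_)
open import Relation.Unary using (Pred; _∈_)

record OrderedField c ℓ₁ ℓ₂ : Set (lsuc (c ⊔ ℓ₁ ⊔ ℓ₂)) where
  field
    commutativeRing : CommutativeRing c ℓ₁
  open CommutativeRing commutativeRing public
  infix 4 _≤_
  field
    _≤_             : Rel Carrier ℓ₂
    isDecTotalOrder : IsDecTotalOrder _≈_ _≤_
    0≉1             : ¬ 0# ≈ 1#
    recip           : ∀ x → ¬ x ≈ 0# → Carrier
    recip-inverse   : ∀ x (x≉0 : ¬ x ≈ 0#) → x * recip x x≉0 ≈ 1#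
    +-monoˡ-≤       : ∀ x {y z} → y ≤ z → y + x ≤ z + x
    *-nonNeg        : ∀ {x y} → 0# ≤ x → 0# ≤ y → 0# ≤ x * y
  open IsDecTotalOrder isDecTotalOrder public using (_≟_; _≤?_)

  ∣_∣ : Carrier → Carrier
  ∣ x ∣ with 0# ≤? x
  ... | yes _ = x
  ... | no  _ = - x

-- The real numbers, given axiomatically (the standard library has none) as a
-- Dedekind-complete ordered field, which determines them up to isomorphism.
-- Equality and order are decidable, i.e. these are the classical reals.
record Reals c ℓ₁ ℓ₂ : Set (lsuc (c ⊔ ℓ₁ ⊔ ℓ₂)) where
  field
    orderedField : OrderedField c ℓ₁ ℓ₂
  open OrderedField orderedField public

  UpperBound : Pred Carrier (c ⊔ ℓ₁ ⊔ ℓ₂) → Carrier → Set (c ⊔ ℓ₁ ⊔ ℓ₂)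
  UpperBound P u = ∀ x → x ∈ P → x ≤ u

  field
    supremum : ∀ (P : Pred Carrier (c ⊔ ℓ₁ ⊔ ℓ₂)) → ∃ P → ∃ (UpperBound P) →
               ∃[ s ] UpperBound P s × (∀ u → UpperBound P u → s ≤ u)

module Elimination {c ℓ₁ ℓ₂} (F : OrderedField c ℓ₁ ℓ₂) where

  open OrderedField F hiding (zero)
  open RawMonoidDefs +-rawMonoid using (sum)

  Matrix : ℕ → ℕ → Set c
  Matrix m n = Fin m → Fin n → Carrier

  infixl 7 _·_
  _·_ : ∀ {m n p} → Matrix m n → Matrix n p → Matrix m p
  (A · B) i j = sum λ t → A i t * B t j

  -- Rank: the largest size of a linearly independent family of columns.

  LinearlyIndependent : ∀ {p m} → (Fin p → Vector Carrier m) → Set (c ⊔ ℓ₁)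
  LinearlyIndependent {p} v = ∀ (x : Vector Carrier p) →
    (∀ i → sum (λ t → x t * v t i) ≈ 0#) → ∀ t → x t ≈ 0#

  columns : ∀ {m n p} → Matrix m n → (Fin p → Fin n) → Fin p → Vector Carrier m
  columns A J t i = A i (J t)

  HasRank : ∀ {m n} → Matrix m n → ℕ → Set (c ⊔ ℓ₁)
  HasRank {m} {n} A r =
    (∃[ J ] LinearlyIndependent (columns {p = r} A J)) ×
    (∀ p (J : Fin p → Fin n) → LinearlyIndependent (columns A J) → p ℕ.≤ r)

  signed : ℕ → Carrier → Carrier
  signed zero    x = x
  signed (suc k) x = - signed k x

  -- Laplace expansion along the first row.
  det : ∀ {p} → Matrix p p → Carrier
  det {zero}  M = 1#
  det {suc p} M = sum λ j →
    signed (toℕ j) (M zero j * det (λ a b → M (suc a) (punchIn j b)))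

  minor : ∀ {m n p} → Matrix m n → (Fin p → Fin m) → (Fin p → Fin n) → Carrier
  minor A I J = det λ a b → A (I a) (J b)

  first : ∀ {m} k → .(k ℕ.≤ m) → Fin k → Fin m
  first k k≤m a = inject≤ a k≤m

  -- The index tuple (1, …, k, i), which is increasing when k ≤ toℕ i.
  firstThen : ∀ {m} k → .(k ℕ.≤ m) → Fin m → Fin (k ℕ.+ 1) → Fin m
  firstThen k k≤m i = first k k≤m ++ λ (_ : Fin 1) → i

  leadingMinor : ∀ {m n} → Matrix m n → ∀ k → .(k ℕ.≤ m) → .(k ℕ.≤ n) → Carrier
  leadingMinor A k k≤m k≤n = minor A (first k k≤m) (first k k≤n)

  -- Elements of Fin are 0-based, so the 1-based condition k + 1 ≤ i on an index
  -- reads k ≤ toℕ i, and the (k+1)-st index is fromℕ< of a proof of k < m.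

  ProperlyArranged : ∀ {m n} → Matrix m n → Set ℓ₂
  ProperlyArranged {m} {n} A =
    (∀ (0<m : 0 ℕ.< m) (0<n : 0 ℕ.< n) i j →
       ∣ A i j ∣ ≤ ∣ A (fromℕ< 0<m) (fromℕ< 0<n) ∣) ×
    (∀ k → 1 ℕ.≤ k → k ℕ.< m ⊓ n →
       ∀ (k<m : k ℕ.< m) (k<n : k ℕ.< n) i j → k ℕ.≤ toℕ i → k ℕ.≤ toℕ j →
       ∣ minor A (firstThen k (ℕ.<⇒≤ k<m) i) (firstThen k (ℕ.<⇒≤ k<n) j) ∣
         ≤ ∣ leadingMinor A (suc k) k<m k<n ∣)

  scaling : ∀ {m} → Fin m → Carrier → Matrix m m
  scaling p x i j with i Fin.≟ j | i Fin.≟ p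
  ... | yes _ | yes _ = x
  ... | yes _ | no  _ = 1#
  ... | no  _ | _     = 0#

  clearing : ∀ {m n} → Fin m → Fin n → Matrix m n → Matrix m m
  clearing p q B i j with i Fin.≟ j | j Fin.≟ p
  ... | yes _ | _     = 1#
  ... | no  _ | yes _ = - B i q
  ... | no  _ | no  _ = 0#

  -- The (k+1, k+1) position, if the matrix has one.
  diagonal : ∀ m n → ℕ → Maybe (Fin m × Fin n)
  diagonal m n k with k ℕ.<? m | k ℕ.<? n
  ... | yes k<m | yes k<n = just (fromℕ< k<m , fromℕ< k<n)
  ... | _       | _       = nothing

  normalise : ∀ {m n} → Matrix m n → Fin m × Fin n → Maybe (Matrix m n)
  normalise B (p , q) with B p q ≟ 0#
  ... | yes _   = nothing
  ... | no  b≉0 = just (scaling p (recip (B p q) b≉0) · B)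

  clear : ∀ {m n} → Matrix m n → Fin m × Fin n → Maybe (Matrix m n)
  clear B (p , q) = just (clearing p q B · B)

  -- gjEven A k is A^(2k) and gjOdd A k is A^(2k+1); nothing means undefined.
  gjEven gjOdd : ∀ {m n} → Matrix m n → ℕ → Maybe (Matrix m n)
  gjEven         A zero    = just A
  gjEven {m} {n} A (suc k) = gjOdd A k >>= λ B → diagonal m n k >>= clear B
  gjOdd  {m} {n} A k       = gjEven A k >>= λ B → diagonal m n k >>= normalise B

  -- Here k runs over 0, …, r - 1, so it stands for k - 1 in the usual condition
  -- "A^(2k-2) is defined and has nonzero (k, k) entry for k = 1, …, r".
  DiagonallyEliminable : ∀ {m n} → Matrix m n → ℕ → Set (c ⊔ ℓ₁)
  DiagonallyEliminable {m} {n} A r = ∀ k → k ℕ.< r →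
    Σ (k ℕ.< m) λ k<m → Σ (k ℕ.< n) λ k<n →
    ∃[ B ] gjEven A k ≡ just B × ¬ B (fromℕ< k<m) (fromℕ< k<n) ≈ 0#

{-# OPTIONS --safe #-}

-- Let B = A^(2k).  Elimination preserves the identity
--   a_ij = Σ_{s ≤ k} a_is b_sj + [i > k] b_ij,
-- so in the submatrix of A with rows 1, …, k, i and columns 1, …, k, j
-- (i, j > k) column operations turn the last column into (0, …, 0, b_ij), and
-- the bordered minor equals m_k b_ij.  As m_k ≠ 0, proper arrangement says
-- exactly that b_{k+1,k+1} dominates the entries b_ij with i, j > k.  If that
-- pivot vanished, all rows of B below the k-th would vanish, and the identity
-- would factor A through a k-dimensional space, forcing r ≤ k.
module Submission where

import Algebra.Properties.Ring as RingProperties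
import Algebra.Properties.Semiring.Sum as SemiringSum
import Algebra.Solver.Ring.NaturalCoefficients.Default as SemiringSolver
open import Data.Fin.Base using (Fin; zero; suc; toℕ; fromℕ; fromℕ<; inject₁; inject≤; punchIn; punchOut; cast; _↑ˡ_; _↑ʳ_)
import Data.Fin.Properties as Fin
open import Data.Maybe.Base using (just)
import Data.Maybe.Properties as Maybe
open import Data.Nat.Base as ℕ using (ℕ; zero; suc)
import Data.Nat.Properties as ℕ
open import Data.Product.Base using (Σ; _×_; _,_; proj₁; proj₂)
open import Data.Sum.Base as Sum using (_⊎_; inj₁; inj₂)
open import Data.Vec.Functional using (Vector; updateAt; insertAt)
import Data.Vec.Functional.Properties as Vector
open import Function.Base using (_∘_; const)
import Relation.Binary.Reasoning.Setoid as SetoidReasoning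
open import Relation.Binary.PropositionalEquality.Core as ≡ using (_≡_; _≢_)
open import Relation.Binary.Structures using (IsDecTotalOrder)
open import Relation.Nullary.Decidable.Core using (yes; no)
open import Relation.Nullary.Negation.Core using (¬_; contradiction)
open import Defs

-- That m_k is nonzero belongs to the induction: the bordered minor at (k+1, k+1) reads m_{k+1} =
-- m_k b_{k+1,k+1}, so each nonzero pivot keeps the next leading minor nonzero. The identity keeps
-- its shape because it mentions only entries of A and B. Rewriting B by the next matrix C, the
-- coefficient collected by the pivot row of C in row i is the identity at column k+1, that is, the
-- entry a_{i,k+1} itself. Proper arrangement controls b_ij only for j > k. For j ≤ k the entries
-- below row k are zero because those columns have been cleared; the two facts together make a zero
-- pivot annihilate whole rows. As `det` is the expansion along the first row, the main work on
-- determinants is to derive the column rules from it: linearity in a column, the sign change under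
-- an adjacent swap, and from it vanishing for a repeated column.

module Theory {c ℓ₁ ℓ₂} (F : OrderedField c ℓ₁ ℓ₂) where

  open OrderedField F hiding (zero)
  open Elimination F
  open RingProperties ring
  open SemiringSum semiring
  open SemiringSolver commutativeSemiring using (solve; _:+_; _:*_; _:=_)
  open IsDecTotalOrder isDecTotalOrder using (antisym; total) renaming (refl to ≤-refl; ≤-respˡ-≈ to ≤-respˡ; ≤-respʳ-≈ to ≤-respʳ)
  open SetoidReasoning setoid

  -- Absolute values

  0≤-x : ∀ {x} → x ≤ 0# → 0# ≤ - x
  0≤-x {x} x≤0 = ≤-respʳ (+-identityˡ (- x)) (≤-respˡ (-‿inverseʳ x) (+-monoˡ-≤ (- x) x≤0))

  -x≤0 : ∀ {x} → 0# ≤ x → - x ≤ 0#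
  -x≤0 {x} 0≤x = ≤-respʳ (-‿inverseʳ x) (≤-respˡ (+-identityˡ (- x)) (+-monoˡ-≤ (- x) 0≤x))

  0≰x⇒0≤-x : ∀ {x} → ¬ 0# ≤ x → 0# ≤ - x
  0≰x⇒0≤-x {x} 0≰x with total 0# x
  ... | inj₁ 0≤x = contradiction 0≤x 0≰x
  ... | inj₂ x≤0 = 0≤-x x≤0

  -- The order takes the place of dividing by two: `x` and `- x` lie on opposite sides of `0#`. This
  -- is what turns a sign change under a column swap into a vanishing determinant.
  x≈-x⇒x≈0 : ∀ {x} → x ≈ - x → x ≈ 0#
  x≈-x⇒x≈0 {x} x≈-x with total 0# x
  ... | inj₁ 0≤x = antisym (≤-respˡ (sym x≈-x) (-x≤0 0≤x)) 0≤x
  ... | inj₂ x≤0 = antisym x≤0 (≤-respʳ (sym x≈-x) (0≤-x x≤0))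

  *-monoʳ-≤ : ∀ {z x y} → 0# ≤ z → x ≤ y → z * x ≤ z * y
  *-monoʳ-≤ {z} {x} {y} 0≤z x≤y =
    ≤-respʳ eq (≤-respˡ (+-identityˡ (z * x)) (+-monoˡ-≤ (z * x) (*-nonNeg 0≤z 0≤y-x)))
    where
    0≤y-x : 0# ≤ y + - x
    0≤y-x = ≤-respˡ (-‿inverseʳ x) (+-monoˡ-≤ (- x) x≤y)
    eq : z * (y + - x) + z * x ≈ z * y
    eq = begin
      z * (y + - x) + z * x  ≈⟨ distribˡ z (y + - x) x ⟨
      z * (y + - x + x)      ≈⟨ *-congˡ (+-assoc y (- x) x) ⟩
      z * (y + (- x + x))    ≈⟨ *-congˡ (+-congˡ (-‿inverseˡ x)) ⟩
      z * (y + 0#)           ≈⟨ *-congˡ (+-identityʳ y) ⟩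
      z * y                  ∎

  0≤∣x∣ : ∀ x → 0# ≤ ∣ x ∣
  0≤∣x∣ x with 0# ≤? x
  ... | yes 0≤x = 0≤x
  ... | no  0≰x = 0≰x⇒0≤-x 0≰x

  ∣x∣≈±x : ∀ x → ∣ x ∣ ≈ x ⊎ ∣ x ∣ ≈ - x
  ∣x∣≈±x x with 0# ≤? x
  ... | yes _ = inj₁ refl
  ... | no  _ = inj₂ refl

  -- Characterises the absolute value by its sign and its two possible values, so that congruence
  -- and multiplicativity follow without unfolding the decision inside `∣_∣`.
  ∣∣-unique : ∀ {x y} → 0# ≤ y → y ≈ x ⊎ y ≈ - x → ∣ x ∣ ≈ y
  ∣∣-unique {x} 0≤y y≈±x with 0# ≤? x | y≈±x
  ... | yes _   | inj₁ y≈x  = sym y≈x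
  ... | yes 0≤x | inj₂ y≈-x = begin
    x    ≈⟨ antisym (≤-respˡ (-‿involutive x) (-x≤0 (≤-respʳ y≈-x 0≤y))) 0≤x ⟩
    0#   ≈⟨ antisym (≤-respʳ y≈-x 0≤y) (-x≤0 0≤x) ⟩
    - x  ≈⟨ y≈-x ⟨
    _    ∎
  ... | no 0≰x  | inj₁ y≈x  = contradiction (≤-respʳ y≈x 0≤y) 0≰x
  ... | no _    | inj₂ y≈-x = sym y≈-x

  ∣∣-cong : ∀ {x y} → x ≈ y → ∣ x ∣ ≈ ∣ y ∣
  ∣∣-cong {x} {y} x≈y = ∣∣-unique (0≤∣x∣ y) (Sum.map (λ e → trans e (sym x≈y)) (λ e → trans e (-‿cong (sym x≈y))) (∣x∣≈±x y))

  ∣x*y∣≈∣x∣*∣y∣ : ∀ x y → ∣ x * y ∣ ≈ ∣ x ∣ * ∣ y ∣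
  ∣x*y∣≈∣x∣*∣y∣ x y = ∣∣-unique (*-nonNeg (0≤∣x∣ x) (0≤∣x∣ y)) signs
    where
    signs : ∣ x ∣ * ∣ y ∣ ≈ x * y ⊎ ∣ x ∣ * ∣ y ∣ ≈ - (x * y)
    signs with ∣x∣≈±x x | ∣x∣≈±x y
    ... | inj₁ p | inj₁ q = inj₁ (*-cong p q)
    ... | inj₁ p | inj₂ q = inj₂ (trans (*-cong p q) (sym (-‿distribʳ-* x y)))
    ... | inj₂ p | inj₁ q = inj₂ (trans (*-cong p q) (sym (-‿distribˡ-* x y)))
    ... | inj₂ p | inj₂ q = inj₁ (begin
      ∣ x ∣ * ∣ y ∣  ≈⟨ *-cong p q ⟩
      - x * - y      ≈⟨ -‿distribˡ-* x (- y) ⟨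
      - (x * - y)    ≈⟨ -‿cong (-‿distribʳ-* x y) ⟨
      - - (x * y)    ≈⟨ -‿involutive (x * y) ⟩
      x * y          ∎)

  recip-cancel : ∀ {z} (z≉0 : ¬ z ≈ 0#) x → recip z z≉0 * (z * x) ≈ x
  recip-cancel {z} z≉0 x = begin
    recip z z≉0 * (z * x)  ≈⟨ *-assoc (recip z z≉0) z x ⟨
    recip z z≉0 * z * x    ≈⟨ *-congʳ (*-comm (recip z z≉0) z) ⟩
    z * recip z z≉0 * x    ≈⟨ *-congʳ (recip-inverse z z≉0) ⟩
    1# * x                 ≈⟨ *-identityˡ x ⟩
    x                      ∎

  x*y≉0 : ∀ {x y} → ¬ x ≈ 0# → ¬ y ≈ 0# → ¬ x * y ≈ 0#
  x*y≉0 {x} {y} x≉0 y≉0 xy≈0 = y≉0 (begin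
    y                      ≈⟨ recip-cancel x≉0 y ⟨
    recip x x≉0 * (x * y)  ≈⟨ *-congˡ xy≈0 ⟩
    recip x x≉0 * 0#       ≈⟨ zeroʳ (recip x x≉0) ⟩
    0#                     ∎)

  ∣∣-*-cancelˡ-≤ : ∀ {z x y} → ¬ z ≈ 0# → ∣ z * x ∣ ≤ ∣ z * y ∣ → ∣ x ∣ ≤ ∣ y ∣
  ∣∣-*-cancelˡ-≤ {z} {x} {y} z≉0 zx≤zy =
    ≤-respʳ (scaled y) (≤-respˡ (scaled x) (*-monoʳ-≤ (0≤∣x∣ (recip z z≉0)) zx≤zy))
    where
    scaled : ∀ w → ∣ recip z z≉0 ∣ * ∣ z * w ∣ ≈ ∣ w ∣
    scaled w = trans (sym (∣x*y∣≈∣x∣*∣y∣ (recip z z≉0) (z * w))) (∣∣-cong (recip-cancel z≉0 w))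

  ∣x∣≤∣y∣∧y≈0⇒x≈0 : ∀ {x y} → ∣ x ∣ ≤ ∣ y ∣ → y ≈ 0# → x ≈ 0#
  ∣x∣≤∣y∣∧y≈0⇒x≈0 {x} {y} ∣x∣≤∣y∣ y≈0 = sign (∣x∣≈±x x)
    where
    ∣x∣≈0 : ∣ x ∣ ≈ 0#
    ∣x∣≈0 = antisym (≤-respʳ (∣∣-unique ≤-refl (inj₁ (sym y≈0))) ∣x∣≤∣y∣) (0≤∣x∣ x)
    sign : ∣ x ∣ ≈ x ⊎ ∣ x ∣ ≈ - x → x ≈ 0#
    sign (inj₁ ∣x∣≈x)  = trans (sym ∣x∣≈x) ∣x∣≈0
    sign (inj₂ ∣x∣≈-x) = begin
      x        ≈⟨ -‿involutive x ⟨
      - - x    ≈⟨ -‿cong ∣x∣≈-x ⟨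
      - ∣ x ∣  ≈⟨ -‿cong ∣x∣≈0 ⟩
      - 0#     ≈⟨ -0#≈0# ⟩
      0#       ∎

  -- Sums

  sum-zero : ∀ {n} (f : Vector Carrier n) → (∀ t → f t ≈ 0#) → sum f ≈ 0#
  sum-zero {n} f f≈0 = trans (sum-cong-≋ f≈0) (sum-replicate-zero n)

  sum-neg : ∀ {n} (f : Vector Carrier n) → sum (λ t → - f t) ≈ - sum f
  sum-neg {zero}  f = sym -0#≈0#
  sum-neg {suc n} f = trans (+-congˡ (sum-neg (f ∘ suc))) (-‿+-comm (f zero) (sum (f ∘ suc)))

  sum-linear : ∀ {n} x (f g : Vector Carrier n) → sum (λ t → f t + x * g t) ≈ sum f + x * sum g
  sum-linear x f g = trans (∑-distrib-+ f (λ t → x * g t)) (+-congˡ (sym (*-distribˡ-sum x g)))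

  sum-single : ∀ {n} (p : Fin n) (f : Vector Carrier n) → (∀ t → t ≢ p → f t ≈ 0#) → sum f ≈ f p
  sum-single {suc n} p f f≈0 = begin
    sum f                       ≈⟨ sum-remove f ⟩
    f p + sum (f ∘ punchIn p)   ≈⟨ +-congˡ (sum-zero (f ∘ punchIn p) (λ t → f≈0 _ (Fin.punchInᵢ≢i p t))) ⟩
    f p + 0#                    ≈⟨ +-identityʳ (f p) ⟩
    f p                         ∎

  sum-pair : ∀ {n} {p q : Fin n} (f : Vector Carrier n) → p ≢ q →
             (∀ t → t ≢ p → t ≢ q → f t ≈ 0#) → sum f ≈ f p + f q
  sum-pair {suc n} {p} {q} f p≢q f≈0 = begin
    sum f                                    ≈⟨ sum-remove f ⟩
    f p + sum (f ∘ punchIn p)                ≈⟨ +-congˡ (sum-single (punchOut p≢q) (f ∘ punchIn p) rest) ⟩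
    f p + f (punchIn p (punchOut p≢q))       ≡⟨ ≡.cong (λ t → f p + f t) (Fin.punchIn-punchOut p≢q) ⟩
    f p + f q                                ∎
    where
    rest : ∀ t → t ≢ punchOut p≢q → f (punchIn p t) ≈ 0#
    rest t t≢ = f≈0 _ (Fin.punchInᵢ≢i p t)
      (λ e → t≢ (Fin.punchIn-injective p _ _ (≡.trans e (≡.sym (Fin.punchIn-punchOut p≢q)))))

  -- Determinants

  signed-* : ∀ k x → signed k x ≈ signed k 1# * x
  signed-* zero    x = sym (*-identityˡ x)
  signed-* (suc k) x = trans (-‿cong (signed-* k x)) (-‿distribˡ-* (signed k 1#) x)

  signed-cong : ∀ k {x y} → x ≈ y → signed k x ≈ signed k y
  signed-cong zero    x≈y = x≈y
  signed-cong (suc k) x≈y = -‿cong (signed-cong k x≈y)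

  signed-zero : ∀ k {x} → x ≈ 0# → signed k x ≈ 0#
  signed-zero k {x} x≈0 = trans (signed-* k x) (trans (*-congˡ x≈0) (zeroʳ (signed k 1#)))

  signed-neg : ∀ k x → signed k (- x) ≈ - signed k x
  signed-neg zero    x = refl
  signed-neg (suc k) x = -‿cong (signed-neg k x)

  signed-linear : ∀ k x y z → signed k (y + x * z) ≈ signed k y + x * signed k z
  signed-linear k x y z = begin
    signed k (y + x * z)                       ≈⟨ signed-* k _ ⟩
    signed k 1# * (y + x * z)                  ≈⟨ solve 4 (λ s x y z → s :* (y :+ x :* z) := s :* y :+ x :* (s :* z)) refl (signed k 1#) x y z ⟩
    signed k 1# * y + x * (signed k 1# * z)    ≈⟨ +-cong (signed-* k y) (*-congˡ (signed-* k z)) ⟨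
    signed k y + x * signed k z                ∎

  det-cong : ∀ {p} {M N : Matrix p p} → (∀ i j → M i j ≈ N i j) → det M ≈ det N
  det-cong {zero}  M≈N = refl
  det-cong {suc p} M≈N = sum-cong-≋ λ j → signed-cong (toℕ j)
    (*-cong (M≈N zero j) (det-cong λ a b → M≈N (suc a) (punchIn j b)))

  det-cast : ∀ {p q} (q≡p : q ≡ p) (M : Matrix p p) → det (λ a b → M (cast q≡p a) (cast q≡p b)) ≈ det M
  det-cast ≡.refl M = det-cong λ a b → reflexive (≡.cong₂ M (Fin.cast-is-id ≡.refl a) (Fin.cast-is-id ≡.refl b))

  -- Three matrices that agree off column `q` form a pattern stable under the expansion: deleting
  -- another column leaves the same pattern at `punchOut j≢q`, which is the induction, while
  -- deleting `q` itself makes the three submatrices equal.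
  det-linear : ∀ {p} (q : Fin p) x (P M N : Matrix p p) → (∀ i → P i q ≈ M i q + x * N i q) →
               (∀ i j → j ≢ q → P i j ≈ M i j) → (∀ i j → j ≢ q → P i j ≈ N i j) →
               det P ≈ det M + x * det N
  det-linear {suc p} q x P M N Pq P≈M P≈N = begin
    sum (term P)                            ≈⟨ sum-cong-≋ term-linear ⟩
    sum (λ j → term M j + x * term N j)     ≈⟨ sum-linear x (term M) (term N) ⟩
    sum (term M) + x * sum (term N)         ∎
    where
    sub : Matrix (suc p) (suc p) → Fin (suc p) → Matrix p p
    sub L j a b = L (suc a) (punchIn j b)

    term : Matrix (suc p) (suc p) → Fin (suc p) → Carrier
    term L j = signed (toℕ j) (L zero j * det (sub L j))

    product-linear : ∀ j → P zero j * det (sub P j) ≈ M zero j * det (sub M j) + x * (N zero j * det (sub N j))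
    product-linear j with j Fin.≟ q
    ... | yes ≡.refl = begin
      P zero j * det (sub P j)                                          ≈⟨ *-congʳ (Pq zero) ⟩
      (M zero j + x * N zero j) * det (sub P j)                         ≈⟨ solve 4 (λ x m n d → (m :+ x :* n) :* d := m :* d :+ x :* (n :* d)) refl x (M zero j) (N zero j) (det (sub P j)) ⟩
      M zero j * det (sub P j) + x * (N zero j * det (sub P j))         ≈⟨ +-cong (*-congˡ (det-cong λ a b → P≈M (suc a) _ (Fin.punchInᵢ≢i j b)))
                                                                              (*-congˡ (*-congˡ (det-cong λ a b → P≈N (suc a) _ (Fin.punchInᵢ≢i j b)))) ⟩
      M zero j * det (sub M j) + x * (N zero j * det (sub N j))         ∎
    ... | no j≢q = begin
      P zero j * det (sub P j)                                          ≈⟨ *-congˡ sub-linear ⟩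
      P zero j * (det (sub M j) + x * det (sub N j))                    ≈⟨ solve 4 (λ x y m n → y :* (m :+ x :* n) := y :* m :+ x :* (y :* n)) refl x (P zero j) (det (sub M j)) (det (sub N j)) ⟩
      P zero j * det (sub M j) + x * (P zero j * det (sub N j))         ≈⟨ +-cong (*-congʳ (P≈M zero j j≢q)) (*-congˡ (*-congʳ (P≈N zero j j≢q))) ⟩
      M zero j * det (sub M j) + x * (N zero j * det (sub N j))         ∎
      where
      q′ : Fin p
      q′ = punchOut j≢q
      jq′ : punchIn j q′ ≡ q
      jq′ = Fin.punchIn-punchOut j≢q
      off : ∀ b → b ≢ q′ → punchIn j b ≢ q
      off b b≢q′ e = b≢q′ (Fin.punchIn-injective j b q′ (≡.trans e (≡.sym jq′)))
      sub-linear : det (sub P j) ≈ det (sub M j) + x * det (sub N j)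
      sub-linear = det-linear q′ x (sub P j) (sub M j) (sub N j)
        (λ i → ≡.subst (λ t → P (suc i) t ≈ M (suc i) t + x * N (suc i) t) (≡.sym jq′) (Pq (suc i)))
        (λ i b b≢q′ → P≈M (suc i) _ (off b b≢q′))
        (λ i b b≢q′ → P≈N (suc i) _ (off b b≢q′))

    term-linear : ∀ j → term P j ≈ term M j + x * term N j
    term-linear j = trans (signed-cong (toℕ j) (product-linear j)) (signed-linear (toℕ j) x _ _)

  -- Defined by recursion on the position rather than by comparing indices, so that it computes in
  -- step with `punchIn` and with `sum`.
  swapAt : ∀ {n} → Fin n → Fin (suc n) → Fin (suc n)
  swapAt zero    zero          = suc zero
  swapAt zero    (suc zero)    = zero
  swapAt zero    (suc (suc j)) = suc (suc j)
  swapAt (suc c) zero          = zero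
  swapAt (suc c) (suc j)       = suc (swapAt c j)

  sum-swapAt : ∀ {n} (c : Fin n) (f : Vector Carrier (suc n)) → sum (f ∘ swapAt c) ≈ sum f
  sum-swapAt zero    f = solve 3 (λ x y z → x :+ (y :+ z) := y :+ (x :+ z)) refl (f (suc zero)) (f zero) _
  sum-swapAt (suc c) f = +-congˡ (sum-swapAt c (f ∘ suc))

  swapAt-inject₁ : ∀ {n} (c : Fin n) → swapAt c (inject₁ c) ≡ suc c
  swapAt-inject₁ zero    = ≡.refl
  swapAt-inject₁ (suc c) = ≡.cong suc (swapAt-inject₁ c)

  swapAt-suc : ∀ {n} (c : Fin n) → swapAt c (suc c) ≡ inject₁ c
  swapAt-suc zero    = ≡.refl
  swapAt-suc (suc c) = ≡.cong suc (swapAt-suc c)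

  swapAt-other : ∀ {n} (c : Fin n) j → j ≢ inject₁ c → j ≢ suc c → swapAt c j ≡ j
  swapAt-other zero    zero          j≢c _   = contradiction ≡.refl j≢c
  swapAt-other zero    (suc zero)    _   j≢c = contradiction ≡.refl j≢c
  swapAt-other zero    (suc (suc j)) _   _   = ≡.refl
  swapAt-other (suc c) zero          _   _   = ≡.refl
  swapAt-other (suc c) (suc j)       j≢c j≢c′ = ≡.cong suc (swapAt-other c j (j≢c ∘ ≡.cong suc) (j≢c′ ∘ ≡.cong suc))

  -- How deleting column j commutes with swapping columns c and c + 1: if j is
  -- one of the two, the swap is absorbed; otherwise it survives as a swap.
  data SwapView {n} (c : Fin (suc n)) (j : Fin (suc (suc n))) : Set where
    up    : toℕ (swapAt c j) ≡ suc (toℕ j) →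
            (∀ b → swapAt c (punchIn j b) ≡ punchIn (swapAt c j) b) → SwapView c j
    down  : toℕ j ≡ suc (toℕ (swapAt c j)) →
            (∀ b → swapAt c (punchIn j b) ≡ punchIn (swapAt c j) b) → SwapView c j
    fixed : swapAt c j ≡ j → ∀ c′ →
            (∀ b → swapAt c (punchIn j b) ≡ punchIn j (swapAt c′ b)) → SwapView c j

  swapView : ∀ {n} (c : Fin (suc n)) j → SwapView c j
  swapView zero    zero             = up ≡.refl λ { zero → ≡.refl ; (suc b) → ≡.refl }
  swapView zero    (suc zero)       = down ≡.refl λ { zero → ≡.refl ; (suc b) → ≡.refl }
  swapView {suc n} zero (suc (suc j)) =
    fixed ≡.refl zero λ { zero → ≡.refl ; (suc zero) → ≡.refl ; (suc (suc b)) → ≡.refl }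
  swapView (suc c) zero             = fixed ≡.refl c λ b → ≡.refl
  swapView {suc n} (suc c) (suc j) with swapView c j
  ... | up e h       = up (≡.cong suc e) λ { zero → ≡.refl ; (suc b) → ≡.cong suc (h b) }
  ... | down e h     = down (≡.cong suc e) λ { zero → ≡.refl ; (suc b) → ≡.cong suc (h b) }
  ... | fixed e c′ h = fixed (≡.cong suc e) (suc c′) λ { zero → ≡.refl ; (suc b) → ≡.cong suc (h b) }

  -- In the expansion, a swapped column keeps its submatrix and moves by one place, which flips its
  -- sign. Any other column keeps its place, and its submatrix undergoes an adjacent swap, so the
  -- sign comes from induction. Reindexing the sum by the swap restores the original terms.
  det-swapAt : ∀ {p} (c : Fin p) (M : Matrix (suc p) (suc p)) → det (λ a b → M a (swapAt c b)) ≈ - det M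
  det-swapAt {suc p} c M = begin
    sum (λ j → signed (toℕ j) (M zero (swapAt c j) * det (sub′ j)))  ≈⟨ sum-cong-≋ term-swap ⟩
    sum (λ j → - term (swapAt c j))                                  ≈⟨ sum-neg (term ∘ swapAt c) ⟩
    - sum (term ∘ swapAt c)                                          ≈⟨ -‿cong (sum-swapAt c term) ⟩
    - sum term                                                       ∎
    where
    sub sub′ : Fin (suc (suc p)) → Matrix (suc p) (suc p)
    sub  j a b = M (suc a) (punchIn j b)
    sub′ j a b = M (suc a) (swapAt c (punchIn j b))

    term : Fin (suc (suc p)) → Carrier
    term j = signed (toℕ j) (M zero j * det (sub j))

    absorbed : ∀ j → (∀ b → swapAt c (punchIn j b) ≡ punchIn (swapAt c j) b) →
               M zero (swapAt c j) * det (sub′ j) ≈ M zero (swapAt c j) * det (sub (swapAt c j))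
    absorbed j h = *-congˡ (det-cong λ a b → reflexive (≡.cong (M (suc a)) (h b)))

    term-swap : ∀ j → signed (toℕ j) (M zero (swapAt c j) * det (sub′ j)) ≈ - term (swapAt c j)
    term-swap j with swapView c j
    ... | up e h rewrite e = trans (signed-cong (toℕ j) (absorbed j h)) (sym (-‿involutive _))
    ... | down e h rewrite e = -‿cong (signed-cong (toℕ (swapAt c j)) (absorbed j h))
    ... | fixed e c′ h rewrite e = begin
      signed (toℕ j) (M zero j * det (sub′ j))   ≈⟨ signed-cong (toℕ j) (*-congˡ sub-swap) ⟩
      signed (toℕ j) (M zero j * - det (sub j))  ≈⟨ signed-cong (toℕ j) (-‿distribʳ-* _ _) ⟨
      signed (toℕ j) (- (M zero j * det (sub j))) ≈⟨ signed-neg (toℕ j) _ ⟩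
      - term j                                   ∎
      where
      sub-swap : det (sub′ j) ≈ - det (sub j)
      sub-swap = trans (det-cong λ a b → reflexive (≡.cong (M (suc a)) (h b))) (det-swapAt c′ (sub j))

  -- Adjacent swaps bring the two columns together; a matrix with two equal
  -- adjacent columns is unchanged by their swap, so its determinant is its own
  -- negative.
  det-equalColumns : ∀ d {p} (M : Matrix p p) (a b : Fin p) → toℕ b ≡ suc (d ℕ.+ toℕ a) →
                     (∀ i → M i a ≈ M i b) → det M ≈ 0#
  det-equalColumns zero M a (suc c) b≡1+a Ma≈Mb = x≈-x⇒x≈0 (trans (sym (det-cong unchanged)) (det-swapAt c M))
    where
    a≡c : a ≡ inject₁ c
    a≡c = Fin.toℕ-injective (≡.trans (≡.sym (ℕ.suc-injective b≡1+a)) (≡.sym (Fin.toℕ-inject₁ c)))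
    unchanged : ∀ i j → M i (swapAt c j) ≈ M i j
    unchanged i j with j Fin.≟ inject₁ c | j Fin.≟ suc c
    ... | yes ≡.refl | _          rewrite swapAt-inject₁ c = trans (sym (Ma≈Mb i)) (reflexive (≡.cong (M i) a≡c))
    ... | no _       | yes ≡.refl rewrite swapAt-suc c     = trans (reflexive (≡.cong (M i) (≡.sym a≡c))) (Ma≈Mb i)
    ... | no j≢c     | no j≢c′    = reflexive (≡.cong (M i) (swapAt-other c j j≢c j≢c′))
  det-equalColumns (suc d) M a (suc c) b≡1+d+a Ma≈Mb = begin
    det M         ≈⟨ -‿involutive (det M) ⟨
    - - det M     ≈⟨ -‿cong (det-swapAt c M) ⟨
    - det M′      ≈⟨ -‿cong (det-equalColumns d M′ a (inject₁ c) c≡1+d+a M′a≈M′c) ⟩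
    - 0#          ≈⟨ -0#≈0# ⟩
    0#            ∎
    where
    M′ : Matrix _ _
    M′ i j = M i (swapAt c j)
    c≡1+d+a : toℕ (inject₁ c) ≡ suc (d ℕ.+ toℕ a)
    c≡1+d+a = ≡.trans (Fin.toℕ-inject₁ c) (ℕ.suc-injective b≡1+d+a)
    a<c : toℕ a ℕ.< toℕ c
    a<c = ≡.subst (toℕ a ℕ.<_) (≡.sym (ℕ.suc-injective b≡1+d+a)) (ℕ.s≤s (ℕ.m≤n+m (toℕ a) d))
    a-fixed : swapAt c a ≡ a
    a-fixed = swapAt-other c a
      (λ e → ℕ.<⇒≢ a<c (≡.trans (≡.cong toℕ e) (Fin.toℕ-inject₁ c)))
      (λ e → ℕ.<⇒≢ (ℕ.m<n⇒m<1+n a<c) (≡.cong toℕ e))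
    M′a≈M′c : ∀ i → M′ i a ≈ M′ i (inject₁ c)
    M′a≈M′c i rewrite a-fixed | swapAt-inject₁ c = Ma≈Mb i

  -- Matrices whose last column vanishes above the corner

  punchIn-inject₁-fromℕ : ∀ {p} (j : Fin (suc p)) → punchIn (inject₁ j) (fromℕ p) ≡ fromℕ (suc p)
  punchIn-inject₁-fromℕ         zero    = ≡.refl
  punchIn-inject₁-fromℕ {suc p} (suc j) = ≡.cong suc (punchIn-inject₁-fromℕ j)

  punchIn-inject₁ : ∀ {p} (j : Fin (suc p)) b → punchIn (inject₁ j) (inject₁ b) ≡ inject₁ (punchIn j b)
  punchIn-inject₁ zero    b       = ≡.refl
  punchIn-inject₁ (suc j) zero    = ≡.refl
  punchIn-inject₁ (suc j) (suc b) = ≡.cong suc (punchIn-inject₁ j b)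

  -- The last term of the first-row expansion contains a zero entry. Every other term deletes a
  -- column to the left, so its submatrix again has a last column that vanishes above the same
  -- corner, and induction extracts that corner as a common factor.
  det-lastColumn : ∀ {p} (M : Matrix (suc p) (suc p)) → (∀ a → M (inject₁ a) (fromℕ p) ≈ 0#) →
                   det M ≈ det (λ a b → M (inject₁ a) (inject₁ b)) * M (fromℕ p) (fromℕ p)
  det-lastColumn {zero}  M _ = trans (+-identityʳ _) (*-comm (M zero zero) 1#)
  det-lastColumn {suc p} M M≈0 = begin
    sum term                                   ≈⟨ sum-init-last term ⟩
    sum (term ∘ inject₁) + term (fromℕ _)      ≈⟨ +-cong (sum-cong-≋ init-term) (signed-zero (toℕ (fromℕ (suc p))) (trans (*-congʳ (M≈0 zero)) (zeroˡ _))) ⟩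
    sum (λ j → top j * x) + 0#                 ≈⟨ +-identityʳ _ ⟩
    sum (λ j → top j * x)                      ≈⟨ *-distribʳ-sum x top ⟨
    sum top * x                                ∎
    where
    x : Carrier
    x = M (fromℕ (suc p)) (fromℕ (suc p))

    term : Fin (suc (suc p)) → Carrier
    term j = signed (toℕ j) (M zero j * det (λ a b → M (suc a) (punchIn j b)))

    topSub : Fin (suc p) → Matrix p p
    topSub j a b = M (suc (inject₁ a)) (inject₁ (punchIn j b))

    top : Fin (suc p) → Carrier
    top j = signed (toℕ j) (M zero (inject₁ j) * det (topSub j))

    sub-last : ∀ j → det (λ a b → M (suc a) (punchIn (inject₁ j) b)) ≈ det (topSub j) * x
    sub-last j = trans
      (det-lastColumn (λ a b → M (suc a) (punchIn (inject₁ j) b)) λ a → trans (reflexive (≡.cong (M (suc (inject₁ a))) (punchIn-inject₁-fromℕ j))) (M≈0 (suc a)))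
      (*-cong (det-cong λ a b → reflexive (≡.cong (M (suc (inject₁ a))) (punchIn-inject₁ j b)))
              (reflexive (≡.cong (M (fromℕ (suc p))) (punchIn-inject₁-fromℕ j))))

    init-term : ∀ j → term (inject₁ j) ≈ top j * x
    init-term j rewrite Fin.toℕ-inject₁ j = begin
      signed (toℕ j) (M zero (inject₁ j) * _)                              ≈⟨ signed-cong (toℕ j) (*-congˡ (sub-last j)) ⟩
      signed (toℕ j) (M zero (inject₁ j) * (det (topSub j) * x))           ≈⟨ signed-* (toℕ j) _ ⟩
      signed (toℕ j) 1# * (M zero (inject₁ j) * (det (topSub j) * x))      ≈⟨ solve 4 (λ s m d x → s :* (m :* (d :* x)) := s :* (m :* d) :* x) refl _ _ _ x ⟩
      signed (toℕ j) 1# * (M zero (inject₁ j) * det (topSub j)) * x        ≈⟨ *-congʳ (signed-* (toℕ j) _) ⟨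
      top j * x                                                            ∎

  -- Column operations

  replaceColumn : ∀ {m n} → Matrix m n → Fin n → Vector Carrier m → Matrix m n
  replaceColumn M q v i = updateAt (M i) q (const (v i))

  replaceColumn-at : ∀ {m n} (M : Matrix m n) q v i → replaceColumn M q v i q ≡ v i
  replaceColumn-at M q v i = Vector.updateAt-updates q (M i)

  replaceColumn-off : ∀ {m n} (M : Matrix m n) q v i j → j ≢ q → replaceColumn M q v i j ≡ M i j
  replaceColumn-off M q v i j j≢q = Vector.updateAt-minimal j q (M i) j≢q

  replaceColumn-off₂ : ∀ {m n} (M : Matrix m n) q v w i j → j ≢ q →
                       replaceColumn M q v i j ≈ replaceColumn M q w i j
  replaceColumn-off₂ M q v w i j j≢q =
    reflexive (≡.trans (replaceColumn-off M q v i j j≢q) (≡.sym (replaceColumn-off M q w i j j≢q)))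

  det-replaceColumn-linear : ∀ {p} (M : Matrix p p) q x {u v w} → (∀ i → u i ≈ v i + x * w i) →
    det (replaceColumn M q u) ≈ det (replaceColumn M q v) + x * det (replaceColumn M q w)
  det-replaceColumn-linear M q x {u} {v} {w} u≈v+xw = det-linear q x _ _ _ at-q
    (replaceColumn-off₂ M q u v) (replaceColumn-off₂ M q u w)
    where
    at-q : ∀ i → replaceColumn M q u i q ≈ replaceColumn M q v i q + x * replaceColumn M q w i q
    at-q i rewrite replaceColumn-at M q u i | replaceColumn-at M q v i | replaceColumn-at M q w i = u≈v+xw i

  det-replaceColumn-cong : ∀ {p} (M : Matrix p p) q {u v} → (∀ i → u i ≈ v i) →
    det (replaceColumn M q u) ≈ det (replaceColumn M q v)
  det-replaceColumn-cong M q {u} {v} u≈v = det-cong λ i j → at i j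
    where
    at : ∀ i j → replaceColumn M q u i j ≈ replaceColumn M q v i j
    at i j with j Fin.≟ q
    ... | yes ≡.refl rewrite replaceColumn-at M q u i | replaceColumn-at M q v i = u≈v i
    ... | no  j≢q    = replaceColumn-off₂ M q u v i j j≢q

  det-repeatedColumn : ∀ {p} (M : Matrix p p) {a q} → toℕ a ℕ.< toℕ q → det (replaceColumn M q (λ i → M i a)) ≈ 0#
  -- The number `toℕ q ∸ suc (toℕ a)` counts the columns strictly between `a` and `q`, hence the
  -- swaps that make the two adjacent.
  det-repeatedColumn M {a} {q} a<q = det-equalColumns (toℕ q ℕ.∸ suc (toℕ a)) _ a q q≡
    λ i → reflexive (≡.trans (replaceColumn-off M q (λ i → M i a) i a (λ a≡q → ℕ.<⇒≢ a<q (≡.cong toℕ a≡q)))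
                       (≡.sym (replaceColumn-at M q (λ i → M i a) i)))
    where
    q≡ : toℕ q ≡ suc (toℕ q ℕ.∸ suc (toℕ a) ℕ.+ toℕ a)
    q≡ = ≡.trans (≡.sym (ℕ.m∸n+n≡m a<q)) (ℕ.+-suc _ (toℕ a))

  -- Linearity splits off one summand at a time, and each of them repeats an earlier column. The
  -- tuple `J` is arbitrary, not an initial segment, so that the induction may drop its first
  -- member.
  det-addColumns : ∀ {n p} (M : Matrix p p) q (J : Fin n → Fin p) → (∀ s → toℕ (J s) ℕ.< toℕ q) →
    ∀ (x : Vector Carrier n) u →
    det (replaceColumn M q (λ i → sum (λ s → M i (J s) * x s) + u i)) ≈ det (replaceColumn M q u)
  det-addColumns {zero}  M q J J<q x u = det-replaceColumn-cong M q λ i → +-identityˡ (u i)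
  det-addColumns {suc n} M q J J<q x u = begin
    det (replaceColumn M q (λ i → sum (λ s → M i (J s) * x s) + u i))
      ≈⟨ det-replaceColumn-linear M q (x zero) (λ i →
           solve 4 (λ m x r u → m :* x :+ r :+ u := r :+ u :+ x :* m) refl
             (M i (J zero)) (x zero) (sum (λ s → M i (J (suc s)) * x (suc s))) (u i)) ⟩
    det (replaceColumn M q (λ i → sum (λ s → M i (J (suc s)) * x (suc s)) + u i))
      + x zero * det (replaceColumn M q (λ i → M i (J zero)))
      ≈⟨ +-cong (det-addColumns M q (J ∘ suc) (J<q ∘ suc) (x ∘ suc) u)
                (trans (*-congˡ (det-repeatedColumn M (J<q zero))) (zeroʳ (x zero))) ⟩
    det (replaceColumn M q u) + 0#
      ≈⟨ +-identityʳ _ ⟩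
    det (replaceColumn M q u) ∎

  -- Kernels of wide matrices

  -- Solves a homogeneous system by elimination, one equation at a time. A zero equation is dropped;
  -- otherwise some variable `p` is eliminated from the remaining equations, which costs one
  -- equation and one unknown. With no equations left, the constant vector `1#` is a nonzero
  -- solution.
  kernel : ∀ {k r} → k ℕ.< r → (N : Matrix k r) →
           Σ (Vector Carrier r) λ x → (∀ s → sum (λ t → x t * N s t) ≈ 0#) × Σ (Fin r) λ t → ¬ x t ≈ 0#
  kernel {zero} {suc r} _ N = const 1# , (λ ()) , zero , 0≉1 ∘ sym
  kernel {suc k} {suc r} 1+k<1+r N with Fin.all? (λ t → N zero t ≟ 0#)
  ... | yes N₀≈0 = x , kill , nonzero
    where
    rest = kernel (ℕ.m<n⇒m<1+n (ℕ.s<s⁻¹ 1+k<1+r)) (N ∘ suc)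
    x = proj₁ rest
    nonzero = proj₂ (proj₂ rest)
    kill : ∀ s → sum (λ t → x t * N s t) ≈ 0#
    kill zero    = sum-zero _ λ t → trans (*-congˡ (N₀≈0 t)) (zeroʳ (x t))
    kill (suc s) = proj₁ (proj₂ rest) s
  ... | no ¬N₀≈0 = insertAt x p y , kill , punchIn p (proj₁ nonzero) ,
                   proj₂ nonzero ∘ trans (reflexive (≡.sym (Vector.insertAt-punchIn x p y (proj₁ nonzero))))
    where
    pivot = Fin.¬∀⟶∃¬ _ _ (λ t → N zero t ≟ 0#) ¬N₀≈0
    p = proj₁ pivot
    b = N zero p
    b⁻¹ = recip b (proj₂ pivot)

    N′ : Matrix k r
    -- Equation `suc s` minus the multiple of the first equation that removes the variable `p`.
    N′ s t = N (suc s) (punchIn p t) + - (N (suc s) p * b⁻¹) * N zero (punchIn p t)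

    rest = kernel (ℕ.s<s⁻¹ 1+k<1+r) N′
    x = proj₁ rest
    nonzero = proj₂ (proj₂ rest)

    S : Fin (suc k) → Carrier
    S s = sum (λ t → x t * N s (punchIn p t))

    y : Carrier
    -- The value of the variable `p` forced by the first equation.
    y = - (b⁻¹ * S zero)

    split : ∀ s → sum (λ t → insertAt x p y t * N s t) ≈ y * N s p + S s
    split s = trans (sum-remove (λ t → insertAt x p y t * N s t))
      (+-cong (*-congʳ (reflexive (Vector.insertAt-lookup x p y)))
              (sum-cong-≋ λ t → *-congʳ (reflexive (Vector.insertAt-punchIn x p y t))))

    kill : ∀ s → sum (λ t → insertAt x p y t * N s t) ≈ 0#
    kill zero = begin
      sum (λ t → insertAt x p y t * N zero t)  ≈⟨ split zero ⟩
      - (b⁻¹ * S zero) * b + S zero            ≈⟨ +-congʳ (-‿distribˡ-* (b⁻¹ * S zero) b) ⟨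
      - (b⁻¹ * S zero * b) + S zero            ≈⟨ +-congʳ (-‿cong (trans (solve 3 (λ i s b → i :* s :* b := i :* (b :* s)) refl b⁻¹ (S zero) b) (recip-cancel (proj₂ pivot) (S zero)))) ⟩
      - S zero + S zero                        ≈⟨ -‿inverseˡ (S zero) ⟩
      0#                                       ∎
    kill (suc s) = begin
      sum (λ t → insertAt x p y t * N (suc s) t)      ≈⟨ split (suc s) ⟩
      - (b⁻¹ * S zero) * N (suc s) p + S (suc s)      ≈⟨ +-comm _ _ ⟩
      S (suc s) + - (b⁻¹ * S zero) * N (suc s) p      ≈⟨ +-congˡ (trans (sym (-‿distribˡ-* _ _)) (trans (-‿cong (solve 3 (λ i s n → i :* s :* n := n :* i :* s) refl b⁻¹ (S zero) (N (suc s) p))) (-‿distribˡ-* _ _))) ⟩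
      S (suc s) + - (N (suc s) p * b⁻¹) * S zero      ≈⟨ sum-linear _ (λ t → x t * N (suc s) (punchIn p t)) (λ t → x t * N zero (punchIn p t)) ⟨
      sum (λ t → x t * N (suc s) (punchIn p t) + - (N (suc s) p * b⁻¹) * (x t * N zero (punchIn p t)))
        ≈⟨ sum-cong-≋ (λ t → solve 4 (λ x n g z → x :* n :+ g :* (x :* z) := x :* (n :+ g :* z)) refl (x t) _ _ _) ⟩
      sum (λ t → x t * N′ s t)                        ≈⟨ proj₁ (proj₂ rest) s ⟩
      0#                                              ∎

  -- If `k` were less than `r`, the columns of `R` selected by `J` would form a wide matrix. A
  -- nonzero kernel vector of it is sent by `L` to a nontrivial relation among the independent
  -- columns of `A`.
  rank-factorisation : ∀ {m n k r} {A : Matrix m n} (L : Matrix m k) (R : Matrix k n) →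
                       (∀ i j → A i j ≈ (L · R) i j) → HasRank A r → r ℕ.≤ k
  rank-factorisation {k = k} {r} {A} L R A≈LR ((J , independent) , _) = ℕ.≮⇒≥ λ k<r →
    let x , kill , t , xt≉0 = kernel k<r (λ s t → R s (J t))
    in xt≉0 (independent x (λ i → begin
      sum (λ t → x t * A i (J t))                            ≈⟨ sum-cong-≋ (λ t → *-congˡ (A≈LR i (J t))) ⟩
      sum (λ t → x t * sum (λ s → L i s * R s (J t)))        ≈⟨ sum-cong-≋ (λ t → *-distribˡ-sum (x t) (λ s → L i s * R s (J t))) ⟩
      sum (λ t → sum (λ s → x t * (L i s * R s (J t))))      ≈⟨ ∑-comm (λ t s → x t * (L i s * R s (J t))) ⟩
      sum (λ s → sum (λ t → x t * (L i s * R s (J t))))      ≈⟨ sum-cong-≋ (λ s → sum-cong-≋ (λ t → solve 3 (λ x l r → x :* (l :* r) := l :* (x :* r)) refl (x t) (L i s) (R s (J t)))) ⟩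
      sum (λ s → sum (λ t → L i s * (x t * R s (J t))))      ≈⟨ sum-cong-≋ (λ s → *-distribˡ-sum (L i s) (λ t → x t * R s (J t))) ⟨
      sum (λ s → L i s * sum (λ t → x t * R s (J t)))        ≈⟨ sum-zero _ (λ s → trans (*-congˡ (kill s)) (zeroʳ (L i s))) ⟩
      0#                                                     ∎) t)

  -- Elimination steps

  scaling-pivot : ∀ {m n} (p : Fin m) x (B : Matrix m n) j → (scaling p x · B) p j ≈ x * B p j
  scaling-pivot p x B j = trans (sum-single p (λ t → scaling p x p t * B t j) off) at
    where
    off : ∀ t → t ≢ p → scaling p x p t * B t j ≈ 0#
    off t t≢p with p Fin.≟ t
    ... | yes p≡t = contradiction (≡.sym p≡t) t≢p
    ... | no  _   = zeroˡ (B t j)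
    at : scaling p x p p * B p j ≈ x * B p j
    at with p Fin.≟ p
    ... | yes _  = refl
    ... | no p≢p = contradiction ≡.refl p≢p

  scaling-other : ∀ {m n} (p : Fin m) x (B : Matrix m n) i j → i ≢ p → (scaling p x · B) i j ≈ B i j
  scaling-other p x B i j i≢p = trans (sum-single i (λ t → scaling p x i t * B t j) off) at
    where
    off : ∀ t → t ≢ i → scaling p x i t * B t j ≈ 0#
    off t t≢i with i Fin.≟ t
    ... | yes i≡t = contradiction (≡.sym i≡t) t≢i
    ... | no  _   = zeroˡ (B t j)
    at : scaling p x i i * B i j ≈ B i j
    at with i Fin.≟ i | i Fin.≟ p
    ... | yes _  | yes i≡p = contradiction i≡p i≢p
    ... | yes _  | no  _   = *-identityˡ (B i j)
    ... | no i≢i | _       = contradiction ≡.refl i≢i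

  clearing-pivot : ∀ {m n} (p : Fin m) (q : Fin n) (B : Matrix m n) j → (clearing p q B · B) p j ≈ B p j
  clearing-pivot p q B j = trans (sum-single p (λ t → clearing p q B p t * B t j) off) at
    where
    off : ∀ t → t ≢ p → clearing p q B p t * B t j ≈ 0#
    off t t≢p with p Fin.≟ t | t Fin.≟ p
    ... | yes p≡t | _       = contradiction (≡.sym p≡t) t≢p
    ... | no  _   | yes t≡p = contradiction t≡p t≢p
    ... | no  _   | no  _   = zeroˡ (B t j)
    at : clearing p q B p p * B p j ≈ B p j
    at with p Fin.≟ p
    ... | yes _  = *-identityˡ (B p j)
    ... | no p≢p = contradiction ≡.refl p≢p

  clearing-other : ∀ {m n} (p : Fin m) (q : Fin n) (B : Matrix m n) i j → i ≢ p →
                   (clearing p q B · B) i j ≈ B i j + - B i q * B p j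
  clearing-other p q B i j i≢p =
    trans (sum-pair (λ t → clearing p q B i t * B t j) i≢p off) (+-cong at-i at-p)
    where
    off : ∀ t → t ≢ i → t ≢ p → clearing p q B i t * B t j ≈ 0#
    off t t≢i t≢p with i Fin.≟ t | t Fin.≟ p
    ... | yes i≡t | _       = contradiction (≡.sym i≡t) t≢i
    ... | no  _   | yes t≡p = contradiction t≡p t≢p
    ... | no  _   | no  _   = zeroˡ (B t j)
    at-i : clearing p q B i i * B i j ≈ B i j
    at-i with i Fin.≟ i
    ... | yes _  = *-identityˡ (B i j)
    ... | no i≢i = contradiction ≡.refl i≢i
    at-p : clearing p q B i p * B p j ≈ - B i q * B p j
    at-p with i Fin.≟ p | p Fin.≟ p
    ... | yes i≡p | _       = contradiction i≡p i≢p
    ... | no  _   | yes _   = refl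
    ... | no  _   | no  p≢p = contradiction ≡.refl p≢p

  -- Scaling and clearing combined, solved for the old matrix `B`. Without reciprocals or
  -- subtraction it can be substituted directly into the identity for `A`, and the semiring solver
  -- handles the resulting rearrangements.
  PivotStep : ∀ {m n} → Fin m → Fin n → Matrix m n → Matrix m n → Set ℓ₁
  PivotStep p q B C = (∀ j → B p q * C p j ≈ B p j) ×
                      (∀ i j → i ≢ p → B i j ≈ C i j + C p j * B i q)

  pivot : ∀ {m n} (p : Fin m) (q : Fin n) (B : Matrix m n) → ¬ B p q ≈ 0# → Matrix m n
  pivot p q B b≉0 = clearing p q B′ · B′
    where B′ = scaling p (recip (B p q) b≉0) · B

  pivot-step : ∀ {m n} (p : Fin m) (q : Fin n) (B : Matrix m n) (b≉0 : ¬ B p q ≈ 0#) →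
               PivotStep p q B (pivot p q B b≉0)
  pivot-step {m} {n} p q B b≉0 = row , others
    where
    x = recip (B p q) b≉0
    B′ C : Matrix m n
    B′ = scaling p x · B
    C  = pivot p q B b≉0

    row : ∀ j → B p q * C p j ≈ B p j
    row j = begin
      B p q * C p j         ≈⟨ *-congˡ (trans (clearing-pivot p q B′ j) (scaling-pivot p x B j)) ⟩
      B p q * (x * B p j)   ≈⟨ solve 3 (λ b x c → b :* (x :* c) := x :* (b :* c)) refl (B p q) x (B p j) ⟩
      x * (B p q * B p j)   ≈⟨ recip-cancel b≉0 (B p j) ⟩
      B p j                 ∎

    others : ∀ i j → i ≢ p → B i j ≈ C i j + C p j * B i q
    others i j i≢p = sym (begin
      C i j + C p j * B i q                                ≈⟨ +-cong (clearing-other p q B′ i j i≢p) (*-congʳ (clearing-pivot p q B′ j)) ⟩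
      B′ i j + - B′ i q * B′ p j + B′ p j * B i q          ≈⟨ +-congʳ (+-cong (scaling-other p x B i j i≢p) (*-congʳ (-‿cong (scaling-other p x B i q i≢p)))) ⟩
      B i j + - B i q * B′ p j + B′ p j * B i q            ≈⟨ solve 4 (λ u v w z → u :+ v :* w :+ w :* z := u :+ w :* (v :+ z)) refl (B i j) (- B i q) (B′ p j) (B i q) ⟩
      B i j + B′ p j * (- B i q + B i q)                   ≈⟨ +-congˡ (trans (*-congˡ (-‿inverseˡ (B i q))) (zeroʳ (B′ p j))) ⟩
      B i j + 0#                                           ≈⟨ +-identityʳ (B i j) ⟩
      B i j                                                ∎)

  diagonal-just : ∀ {m n k} (k<m : k ℕ.< m) (k<n : k ℕ.< n) → diagonal m n k ≡ just (fromℕ< k<m , fromℕ< k<n)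
  diagonal-just {m} {n} {k} k<m k<n with k ℕ.<? m | k ℕ.<? n
  ... | yes _  | yes _  = ≡.refl
  ... | yes _  | no k≮n = contradiction k<n k≮n
  ... | no k≮m | _      = contradiction k<m k≮m

  gjEven-suc : ∀ {m n k} (A B : Matrix m n) (k<m : k ℕ.< m) (k<n : k ℕ.< n) → gjEven A k ≡ just B →
               ¬ B (fromℕ< k<m) (fromℕ< k<n) ≈ 0# →
               Σ (Matrix m n) λ C → gjEven A (suc k) ≡ just C × PivotStep (fromℕ< k<m) (fromℕ< k<n) B C
  gjEven-suc A B k<m k<n A⟨2k⟩≡B b≉0 rewrite A⟨2k⟩≡B | diagonal-just k<m k<n
    with B (fromℕ< k<m) (fromℕ< k<n) ≟ 0#
  ... | yes b≈0  = contradiction b≈0 b≉0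
  -- The reciprocal takes the proof of nonvanishing as an argument, and `normalise` uses the one
  -- found by its own test; hence `b≉0′` and not the given `b≉0`.
  ... | no  b≉0′ = _ , ≡.refl , pivot-step (fromℕ< k<m) (fromℕ< k<n) B b≉0′

  -- Index tuples

  inject≤-inject₁ : ∀ {k m} (k<m : k ℕ.< m) (s : Fin k) → inject≤ (inject₁ s) k<m ≡ first k (ℕ.<⇒≤ k<m) s
  inject≤-inject₁ k<m s = Fin.toℕ-injective (≡.trans (Fin.toℕ-inject≤ (inject₁ s) k<m)
    (≡.trans (Fin.toℕ-inject₁ s) (≡.sym (Fin.toℕ-inject≤ s (ℕ.<⇒≤ k<m)))))

  inject≤-fromℕ : ∀ {k m} (k<m : k ℕ.< m) → inject≤ (fromℕ k) k<m ≡ fromℕ< k<m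
  inject≤-fromℕ {k} k<m = Fin.toℕ-injective (≡.trans (Fin.toℕ-inject≤ (fromℕ k) k<m)
    (≡.trans (Fin.toℕ-fromℕ k) (≡.sym (Fin.toℕ-fromℕ< k<m))))

  1+k≡k+1 : ∀ k → suc k ≡ k ℕ.+ 1
  1+k≡k+1 k = ℕ.+-comm 1 k

  firstThen-inject₁ : ∀ {k m} .(k≤m : k ℕ.≤ m) i (s : Fin k) →
                      firstThen k k≤m i (cast (1+k≡k+1 k) (inject₁ s)) ≡ first k k≤m s
  firstThen-inject₁ {k} k≤m i s
    rewrite Fin.toℕ-injective {i = cast (1+k≡k+1 k) (inject₁ s)} {j = s ↑ˡ 1}
              (≡.trans (Fin.toℕ-cast (1+k≡k+1 k) (inject₁ s)) (≡.trans (Fin.toℕ-inject₁ s) (≡.sym (Fin.toℕ-↑ˡ s 1))))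
          | Fin.splitAt-↑ˡ k s 1 = ≡.refl

  firstThen-fromℕ : ∀ {k m} .(k≤m : k ℕ.≤ m) i → firstThen k k≤m i (cast (1+k≡k+1 k) (fromℕ k)) ≡ i
  firstThen-fromℕ {k} k≤m i
    rewrite Fin.toℕ-injective {i = cast (1+k≡k+1 k) (fromℕ k)} {j = k ↑ʳ (zero {0})}
              (≡.trans (Fin.toℕ-cast (1+k≡k+1 k) (fromℕ k))
                (≡.trans (Fin.toℕ-fromℕ k) (≡.sym (≡.trans (Fin.toℕ-↑ʳ k (zero {0})) (ℕ.+-identityʳ k)))))
          | Fin.splitAt-↑ʳ k 1 zero = ≡.refl

  -- The elimination invariant

  -- The product of the first `k` columns of `A` with the first `k` rows of `B`. It unfolds to the
  -- form `L · R` with inner dimension `k`, as `rank-factorisation` expects.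
  combination : ∀ {m n} (A B : Matrix m n) k → .(k ℕ.≤ m) → .(k ℕ.≤ n) → Matrix m n
  combination A B k k≤m k≤n i j = sum λ s → A i (first k k≤n s) * B (first k k≤m s) j

  -- A = G⁻¹ B where the first k columns of B are unit vectors and the last
  -- m − k columns of G⁻¹ are unit vectors, so the first k columns of G⁻¹ are
  -- those of A.
  record Reduced {m n} (A : Matrix m n) (k : ℕ) (B : Matrix m n) : Set ℓ₁ where
    field
      k≤m      : k ℕ.≤ m
      k≤n      : k ℕ.≤ n
      above    : ∀ i j → toℕ i ℕ.< k → A i j ≈ combination A B k k≤m k≤n i j
      below    : ∀ i j → k ℕ.≤ toℕ i → A i j ≈ combination A B k k≤m k≤n i j + B i j
      cleared  : ∀ i j → k ℕ.≤ toℕ i → toℕ j ℕ.< k → B i j ≈ 0#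
      leading≉0 : ¬ leadingMinor A k k≤m k≤n ≈ 0#

  reduced-zero : ∀ {m n} (A : Matrix m n) → Reduced A 0 A
  reduced-zero A = record
    { k≤m = ℕ.z≤n ; k≤n = ℕ.z≤n
    ; above = λ _ _ () ; below = λ i j _ → sym (+-identityˡ (A i j)) ; cleared = λ _ _ _ ()
    -- The minor of order zero is `1#`.
    ; leading≉0 = 0≉1 ∘ sym }

  x≈y+z⇒x-y≈z : ∀ {x y z} → x ≈ y + z → x + - y ≈ z
  x≈y+z⇒x-y≈z {x} {y} {z} x≈y+z = trans (+-congʳ x≈y+z) (xyx⁻¹≈y y z)

  module _ {m n} {A : Matrix m n} {k} {B : Matrix m n} (reduced : Reduced A k B) where

    open Reduced reduced

    -- Subtracting from the last column the combination of the first k columns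
    -- given by the invariant leaves only the entry B i j in the last row.
    bordered : ∀ (I : Fin (suc k) → Fin m) (J : Fin (suc k) → Fin n) →
               (∀ s → I (inject₁ s) ≡ first k k≤m s) → (∀ s → J (inject₁ s) ≡ first k k≤n s) →
               k ℕ.≤ toℕ (I (fromℕ k)) →
               minor A I J ≈ leadingMinor A k k≤m k≤n * B (I (fromℕ k)) (J (fromℕ k))
    bordered I J I-first J-first k≤i = begin
      det P                                      ≈⟨ det-cong P≈replaced ⟩
      det (replaceColumn P q (λ a → Σx a + u a)) ≈⟨ det-addColumns P q inject₁ inject₁<q x u ⟩
      det (replaceColumn P q u)                  ≈⟨ det-lastColumn (replaceColumn P q u) u-above ⟩
      det (λ a b → replaceColumn P q u (inject₁ a) (inject₁ b)) * replaceColumn P q u q q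
                                                 ≈⟨ *-cong (det-cong corner) u-last ⟩
      leadingMinor A k k≤m k≤n * B (I q) (J q)   ∎
      where
      q : Fin (suc k)
      q = fromℕ k

      P : Matrix (suc k) (suc k)
      P a b = A (I a) (J b)

      x : Vector Carrier k
      x s = B (first k k≤m s) (J q)

      Σx u : Vector Carrier (suc k)
      Σx a = sum (λ s → P a (inject₁ s) * x s)
      u  a = P a q + - Σx a

      inject₁<q : ∀ s → toℕ (inject₁ s) ℕ.< toℕ q
      inject₁<q s rewrite Fin.toℕ-inject₁ s | Fin.toℕ-fromℕ k = Fin.toℕ<n s

      P≈replaced : ∀ a b → P a b ≈ replaceColumn P q (λ a → Σx a + u a) a b
      P≈replaced a b with b Fin.≟ q
      ... | yes ≡.refl rewrite replaceColumn-at P q (λ a → Σx a + u a) a = begin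
        P a q                     ≈⟨ xyx⁻¹≈y (Σx a) (P a q) ⟨
        Σx a + P a q + - Σx a     ≈⟨ +-assoc _ _ _ ⟩
        Σx a + (P a q + - Σx a)   ∎
      ... | no b≢q rewrite replaceColumn-off P q (λ a → Σx a + u a) a b b≢q = refl

      Σx≈combination : ∀ a → combination A B k k≤m k≤n (I a) (J q) ≈ Σx a
      Σx≈combination a = sum-cong-≋ λ s → *-congʳ (reflexive (≡.cong (A (I a)) (≡.sym (J-first s))))

      u-above : ∀ a → replaceColumn P q u (inject₁ a) q ≈ 0#
      u-above a rewrite replaceColumn-at P q u (inject₁ a) =
        x≈y+z⇒x-y≈z (trans (trans (above (I (inject₁ a)) (J q) Ia<k) (Σx≈combination (inject₁ a))) (sym (+-identityʳ _)))
        where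
        Ia<k : toℕ (I (inject₁ a)) ℕ.< k
        Ia<k rewrite I-first a | Fin.toℕ-inject≤ a k≤m = Fin.toℕ<n a

      u-last : replaceColumn P q u q q ≈ B (I q) (J q)
      u-last rewrite replaceColumn-at P q u q =
        x≈y+z⇒x-y≈z (trans (below (I q) (J q) k≤i) (+-congʳ (Σx≈combination q)))

      corner : ∀ a b → replaceColumn P q u (inject₁ a) (inject₁ b) ≈ A (first k k≤m a) (first k k≤n b)
      corner a b rewrite replaceColumn-off P q u (inject₁ a) (inject₁ b) (λ e → Fin.fromℕ≢inject₁ (≡.sym e))
        = reflexive (≡.cong₂ A (I-first a) (J-first b))

    -- The tuples of `firstThen` are indexed by `Fin (k ℕ.+ 1)` and those of `bordered` by
    -- `Fin (suc k)`, so they are first transported along `cast`.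
    minor-firstThen : ∀ i j → k ℕ.≤ toℕ i →
      minor A (firstThen k k≤m i) (firstThen k k≤n j) ≈ leadingMinor A k k≤m k≤n * B i j
    minor-firstThen i j k≤i = begin
      minor A (firstThen k k≤m i) (firstThen k k≤n j)      ≈⟨ det-cast (1+k≡k+1 k) _ ⟨
      minor A I J                                          ≈⟨ bordered I J (firstThen-inject₁ k≤m i) (firstThen-inject₁ k≤n j)
                                                                (≡.subst (λ t → k ℕ.≤ toℕ t) (≡.sym (firstThen-fromℕ k≤m i)) k≤i) ⟩
      leadingMinor A k k≤m k≤n * B (I (fromℕ k)) (J (fromℕ k)) ≈⟨ *-congˡ (reflexive (≡.cong₂ B (firstThen-fromℕ k≤m i) (firstThen-fromℕ k≤n j))) ⟩
      leadingMinor A k k≤m k≤n * B i j                     ∎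
      where
      I : Fin (suc k) → Fin m
      I a = firstThen k k≤m i (cast (1+k≡k+1 k) a)
      J : Fin (suc k) → Fin n
      J b = firstThen k k≤n j (cast (1+k≡k+1 k) b)

    module _ (k<m : k ℕ.< m) (k<n : k ℕ.< n) where

      private
        p : Fin m
        p = fromℕ< k<m

        q : Fin n
        q = fromℕ< k<n

        k≤p : k ℕ.≤ toℕ p
        k≤p = ℕ.≤-reflexive (≡.sym (Fin.toℕ-fromℕ< k<m))

      -- Serves twice: it rewrites the bound of the arrangement as a multiple of the pivot, and it
      -- carries the nonvanishing of the leading minor to the next step.
      leadingMinor-suc : leadingMinor A (suc k) k<m k<n ≈ leadingMinor A k k≤m k≤n * B p q
      leadingMinor-suc = trans
        (bordered (first (suc k) k<m) (first (suc k) k<n) (inject≤-inject₁ k<m) (inject≤-inject₁ k<n)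
          (≡.subst (λ t → k ℕ.≤ toℕ t) (≡.sym (inject≤-fromℕ k<m)) k≤p))
        (*-congˡ (reflexive (≡.cong₂ B (inject≤-fromℕ k<m) (inject≤-fromℕ k<n))))

      dominant : ProperlyArranged A → ∀ i j → k ℕ.≤ toℕ i → k ℕ.≤ toℕ j → ∣ B i j ∣ ≤ ∣ B p q ∣
      dominant arranged i j k≤i k≤j = ∣∣-*-cancelˡ-≤ leading≉0
        (≤-respʳ (∣∣-cong leadingMinor-suc) (≤-respˡ (∣∣-cong (minor-firstThen i j k≤i)) (bound k ≡.refl)))
        where
        -- The module fixes `k`, so the case split runs over a copy `l`. Case zero needs the
        -- separate bound on single entries, seen as minors of order one, which unfold to
        -- `x * 1# + 0#`.
        bound : ∀ l → l ≡ k → ∣ minor A (firstThen k k≤m i) (firstThen k k≤n j) ∣ ≤ ∣ leadingMinor A (suc k) k<m k<n ∣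
        bound zero    ≡.refl = ≤-respʳ (∣∣-cong (sym (1×1 _))) (≤-respˡ (∣∣-cong (sym (1×1 _))) entries)
          where
          1×1 : ∀ x → x * 1# + 0# ≈ x
          1×1 x = trans (+-identityʳ _) (*-identityʳ x)
          entries : ∣ A i j ∣ ≤ ∣ A (inject≤ zero k<m) (inject≤ zero k<n) ∣
          entries = ≡.subst₂ (λ a b → ∣ A i j ∣ ≤ ∣ A a b ∣) (≡.sym (inject≤-fromℕ k<m)) (≡.sym (inject≤-fromℕ k<n))
            (proj₁ arranged k<m k<n i j)
        bound (suc l) ≡.refl = proj₂ arranged (suc l) (ℕ.s≤s ℕ.z≤n) (ℕ.⊓-glb k<m k<n) k<m k<n i j k≤i k≤j

      -- Substituting the pivot step into the old identity leaves `X i j` and a multiple of `C p j`.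
      -- Its coefficient is the old identity at column `q`, so it equals `A i q`: exactly the
      -- summand by which the combination grows.
      reduced-suc : ∀ {C} → ¬ B p q ≈ 0# → PivotStep p q B C → Reduced A (suc k) C
      reduced-suc {C} b≉0 (pivotRow , otherRows) = record
        { k≤m = k<m ; k≤n = k<n ; above = above′ ; below = below′ ; cleared = cleared′
        ; leading≉0 = λ e → x*y≉0 leading≉0 b≉0 (trans (sym leadingMinor-suc) e) }
        where
        ≢p : ∀ {i} → toℕ i ≢ k → i ≢ p
        ≢p i≢k i≡p = i≢k (≡.trans (≡.cong toℕ i≡p) (Fin.toℕ-fromℕ< k<m))

        ≡p : ∀ {i} → toℕ i ≡ k → i ≡ p
        ≡p i≡k = Fin.toℕ-injective (≡.trans i≡k (≡.sym (Fin.toℕ-fromℕ< k<m)))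

        first≢p : ∀ s → first k k≤m s ≢ p
        first≢p s = ≢p (≡.subst (_≢ k) (≡.sym (Fin.toℕ-inject≤ s k≤m)) (ℕ.<⇒≢ (Fin.toℕ<n s)))

        X : Matrix m n
        X = combination A C k k≤m k≤n

        combination-B : ∀ i j → combination A B k k≤m k≤n i j ≈ X i j + C p j * combination A B k k≤m k≤n i q
        combination-B i j = trans
          (sum-cong-≋ λ s → trans (*-congˡ (otherRows (first k k≤m s) j (first≢p s)))
            (solve 4 (λ a x y z → a :* (x :+ y :* z) := a :* x :+ y :* (a :* z)) refl
              (A i (first k k≤n s)) (C (first k k≤m s) j) (C p j) (B (first k k≤m s) q)))
          (sum-linear (C p j) (λ s → A i (first k k≤n s) * C (first k k≤m s) j) (λ s → A i (first k k≤n s) * B (first k k≤m s) q))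

        combination-suc : ∀ i j → combination A C (suc k) k<m k<n i j ≈ X i j + A i q * C p j
        combination-suc i j = trans (sum-init-last (λ s → A i (first (suc k) k<n s) * C (first (suc k) k<m s) j))
          (+-cong (sum-cong-≋ λ s → reflexive (≡.cong₂ (λ a b → A i a * C b j) (inject≤-inject₁ k<n s) (inject≤-inject₁ k<m s)))
                  (reflexive (≡.cong₂ (λ a b → A i a * C b j) (inject≤-fromℕ k<n) (inject≤-fromℕ k<m))))

        above′ : ∀ i j → toℕ i ℕ.< suc k → A i j ≈ combination A C (suc k) k<m k<n i j
        above′ i j i<1+k with ℕ.m≤n⇒m<n∨m≡n (ℕ.s≤s⁻¹ i<1+k)
        ... | inj₁ i<k = begin
          A i j                                                        ≈⟨ above i j i<k ⟩
          combination A B k k≤m k≤n i j                                ≈⟨ combination-B i j ⟩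
          X i j + C p j * combination A B k k≤m k≤n i q                ≈⟨ +-congˡ (trans (*-comm _ _) (*-congʳ (sym (above i q i<k)))) ⟩
          X i j + A i q * C p j                                        ≈⟨ combination-suc i j ⟨
          combination A C (suc k) k<m k<n i j                          ∎
        -- The pivot row passes from `below` to `above`: its separate term `B p j` is
        -- `B p q * C p j` and is absorbed into the new summand.
        ... | inj₂ i≡k rewrite ≡p i≡k = begin
          A p j                                                        ≈⟨ below p j k≤p ⟩
          combination A B k k≤m k≤n p j + B p j                        ≈⟨ +-cong (combination-B p j) (sym (pivotRow j)) ⟩
          X p j + C p j * combination A B k k≤m k≤n p q + B p q * C p j ≈⟨ solve 4 (λ x c y b → x :+ c :* y :+ b :* c := x :+ (y :+ b) :* c) refl (X p j) (C p j) (combination A B k k≤m k≤n p q) (B p q) ⟩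
          X p j + (combination A B k k≤m k≤n p q + B p q) * C p j      ≈⟨ +-congˡ (*-congʳ (below p q k≤p)) ⟨
          X p j + A p q * C p j                                        ≈⟨ combination-suc p j ⟨
          combination A C (suc k) k<m k<n p j                          ∎

        below′ : ∀ i j → suc k ℕ.≤ toℕ i → A i j ≈ combination A C (suc k) k<m k<n i j + C i j
        below′ i j k<i = begin
          A i j                                                        ≈⟨ below i j (ℕ.<⇒≤ k<i) ⟩
          combination A B k k≤m k≤n i j + B i j                        ≈⟨ +-cong (combination-B i j) (otherRows i j (≢p (ℕ.>⇒≢ k<i))) ⟩
          X i j + C p j * combination A B k k≤m k≤n i q + (C i j + C p j * B i q)
            ≈⟨ solve 5 (λ x c y z b → x :+ c :* y :+ (z :+ c :* b) := x :+ (y :+ b) :* c :+ z) refl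
                 (X i j) (C p j) (combination A B k k≤m k≤n i q) (C i j) (B i q) ⟩
          X i j + (combination A B k k≤m k≤n i q + B i q) * C p j + C i j ≈⟨ +-congʳ (+-congˡ (*-congʳ (below i q (ℕ.<⇒≤ k<i)))) ⟨
          X i j + A i q * C p j + C i j                                ≈⟨ +-congʳ (combination-suc i j) ⟨
          combination A C (suc k) k<m k<n i j + C i j                  ∎

        cancel-pivot : ∀ {y z} → B p q * y ≈ B p q * z → y ≈ z
        cancel-pivot {y} {z} e = trans (sym (recip-cancel b≉0 y)) (trans (*-congˡ e) (recip-cancel b≉0 z))

        cleared′ : ∀ i j → suc k ℕ.≤ toℕ i → toℕ j ℕ.< suc k → C i j ≈ 0#
        cleared′ i j k<i j<1+k = +-cancelʳ (C p j * B i q) _ _ (begin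
          C i j + C p j * B i q    ≈⟨ otherRows i j (≢p (ℕ.>⇒≢ k<i)) ⟨
          B i j                    ≈⟨ column (ℕ.m≤n⇒m<n∨m≡n (ℕ.s≤s⁻¹ j<1+k)) ⟩
          C p j * B i q            ≈⟨ +-identityˡ _ ⟨
          0# + C p j * B i q       ∎)
          where
          -- Left of the pivot column the pivot row of `C` is zero and so is `B i j`; in the pivot
          -- column the pivot row of `C` is one.
          column : toℕ j ℕ.< k ⊎ toℕ j ≡ k → B i j ≈ C p j * B i q
          column (inj₁ j<k) = begin
            B i j          ≈⟨ cleared i j (ℕ.<⇒≤ k<i) j<k ⟩
            0#             ≈⟨ zeroˡ (B i q) ⟨
            0# * B i q     ≈⟨ *-congʳ (cancel-pivot (trans (pivotRow j) (trans (cleared p j k≤p j<k) (sym (zeroʳ _))))) ⟨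
            C p j * B i q  ∎
          column (inj₂ j≡k) rewrite Fin.toℕ-injective {i = j} {j = q} (≡.trans j≡k (≡.sym (Fin.toℕ-fromℕ< k<n))) = begin
            B i q          ≈⟨ *-identityˡ (B i q) ⟨
            1# * B i q     ≈⟨ *-congʳ (cancel-pivot (trans (pivotRow q) (sym (*-identityʳ _)))) ⟨
            C p q * B i q  ∎

    -- Rank bound and nonzero pivots

    rank≤k : ∀ {r} → HasRank A r → (∀ i j → k ℕ.≤ toℕ i → B i j ≈ 0#) → r ℕ.≤ k
    rank≤k hasRank B≈0 = rank-factorisation (λ i s → A i (first k k≤n s)) (λ s j → B (first k k≤m s) j) factor hasRank
      where
      factor : ∀ i j → A i j ≈ combination A B k k≤m k≤n i j
      factor i j with toℕ i ℕ.<? k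
      ... | yes i<k = above i j i<k
      ... | no  i≮k = trans (below i j (ℕ.≮⇒≥ i≮k)) (trans (+-congˡ (B≈0 i j (ℕ.≮⇒≥ i≮k))) (+-identityʳ _))

    -- There are three ways to fail: no row left, no column left, or a zero pivot. Each makes `B`
    -- vanish from row `k` on, respectively vacuously, because all columns are cleared, and by
    -- clearing together with dominance. Then `rank≤k` contradicts `k ℕ.< r`.
    nonzero-pivot : ∀ {r} → HasRank A r → ProperlyArranged A → k ℕ.< r →
                    Σ (k ℕ.< m) λ k<m → Σ (k ℕ.< n) λ k<n → ¬ B (fromℕ< k<m) (fromℕ< k<n) ≈ 0#
    nonzero-pivot hasRank arranged k<r with k ℕ.<? m | k ℕ.<? n
    ... | no k≮m  | _ = contradiction (rank≤k hasRank λ i j k≤i → contradiction (ℕ.≤-<-trans k≤i (Fin.toℕ<n i)) k≮m) (ℕ.<⇒≱ k<r)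
    ... | yes _   | no k≮n = contradiction (rank≤k hasRank λ i j k≤i → cleared i j k≤i (ℕ.<-≤-trans (Fin.toℕ<n j) (ℕ.≮⇒≥ k≮n))) (ℕ.<⇒≱ k<r)
    ... | yes k<m | yes k<n = k<m , k<n , λ b≈0 → ℕ.<⇒≱ k<r (rank≤k hasRank (zero-row b≈0))
      where
      zero-row : B (fromℕ< k<m) (fromℕ< k<n) ≈ 0# → ∀ i j → k ℕ.≤ toℕ i → B i j ≈ 0#
      zero-row b≈0 i j k≤i with toℕ j ℕ.<? k
      ... | yes j<k = cleared i j k≤i j<k
      ... | no  j≮k = ∣x∣≤∣y∣∧y≈0⇒x≈0 (dominant k<m k<n arranged i j k≤i (ℕ.≮⇒≥ j≮k)) b≈0

  -- Definedness and invariant are proved in one induction: the next matrix exists because the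
  -- current pivot is nonzero, and this comes from the invariant of the current matrix.
  reduce : ∀ {m n r} (A : Matrix m n) → HasRank A r → ProperlyArranged A → ∀ k → k ℕ.≤ r →
           Σ (Matrix m n) λ B → gjEven A k ≡ just B × Reduced A k B
  reduce A hasRank arranged zero    _   = A , ≡.refl , reduced-zero A
  reduce A hasRank arranged (suc k) k<r with reduce A hasRank arranged k (ℕ.<⇒≤ k<r)
  ... | B , A⟨2k⟩≡B , reduced with nonzero-pivot reduced hasRank arranged k<r
  ... | k<m , k<n , b≉0 with gjEven-suc A B k<m k<n A⟨2k⟩≡B b≉0
  ... | C , A⟨2k+2⟩≡C , step = C , A⟨2k+2⟩≡C , reduced-suc reduced k<m k<n b≉0 step

theorem2p11 : ∀ {c ℓ₁ ℓ₂} (ℝ : Reals c ℓ₁ ℓ₂) →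
    let open Reals ℝ
        open Elimination orderedField
    in ∀ (m n r : ℕ) (A : Matrix m n) → HasRank A r → 1 ℕ.≤ r → ProperlyArranged A →
       DiagonallyEliminable A r ×
       (∀ k → k ℕ.< r → ∀ B → gjEven A k ≡ just B →
          ∀ (k<m : k ℕ.< m) (k<n : k ℕ.< n) i j → k ℕ.≤ toℕ i → k ℕ.≤ toℕ j →
          ∣ B i j ∣ ≤ ∣ B (fromℕ< k<m) (fromℕ< k<n) ∣)
theorem2p11 ℝ m n r A hasRank _ arranged = eliminable , maximal
  where
  open Reals ℝ
  open Elimination orderedField
  open Theory orderedField

  eliminable : DiagonallyEliminable A r
  eliminable k k<r =
    let B , A⟨2k⟩≡B , reduced = reduce A hasRank arranged k (ℕ.<⇒≤ k<r)
        k<m , k<n , b≉0 = nonzero-pivot reduced hasRank arranged k<r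
    in k<m , k<n , B , A⟨2k⟩≡B , b≉0

  maximal : ∀ k → k ℕ.< r → ∀ B → gjEven A k ≡ just B →
            ∀ (k<m : k ℕ.< m) (k<n : k ℕ.< n) i j → k ℕ.≤ toℕ i → k ℕ.≤ toℕ j →
            ∣ B i j ∣ ≤ ∣ B (fromℕ< k<m) (fromℕ< k<n) ∣
  maximal k k<r B A⟨2k⟩≡B k<m k<n with reduce A hasRank arranged k (ℕ.<⇒≤ k<r)
  -- The given matrix and the one carrying the invariant are values of the same computation, hence
  -- identical.
  ... | B′ , A⟨2k⟩≡B′ , reduced with Maybe.just-injective (≡.trans (≡.sym A⟨2k⟩≡B) A⟨2k⟩≡B′)
  ... | ≡.refl = dominant reduced k<m k<n arranged
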